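{- Let $T$ be a nontrivial tree and let $\ell\geq 1$ be an integer. Then $pc_{1,\ell}(T)$ is equal to the maximum size (number of edges) of subtrees of $T$ with diameter $\ell+1$.
   Context: All graphs are finite, undirected and simple; a tree is nontrivial if it has at least two vertices. An edge-coloring of a graph is an arbitrary map from its edge set to the natural numbers (adjacent edges may share a color). In an edge-colored graph, a path $P$ is a distance $\ell$-proper path if no two edges of $P$ of the same color appear with fewer than $\ell$ edges in between on $P$. For a connected graph $G$, $pc_{1,\ell}(G)$ is the minimum number of colors in an edge-coloring of $G$ such that every pair of distinct vertices of $G$ is connected by at least one distance $\ell$-proper path.
   Formalization: If T has no subtree of diameter ℓ+1 (e.g. a single edge with ℓ=1), the maximum is over the empty set; equality with diameter exactly ℓ+1 is asserted when such a subtree exists, and with diameter at most ℓ+1 for every T. -}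

module Defs where

open import Data.Bool.Base using (Bool; T)
open import Data.Bool.Properties using (T?)
open import Data.Fin.Base as Fin using (Fin; toℕ)
import Data.Fin.Properties as Fin
open import Data.Fin.Subset using (Subset; _∈_; _⊆_; Nonempty; ∣_∣)
open import Data.List.Base
  using (List; []; _∷_; length; map; filter; lookup; deduplicate; allFin; cartesianProduct)
open import Data.List.Relation.Unary.Unique.Propositional using (Unique)
open import Data.Nat.Base using (ℕ; suc; _∸_; _≤_; _<_)
import Data.Nat.Properties as ℕ
open import Data.Product.Base using (∃-syntax; _×_; _,_)
open import Relation.Binary.PropositionalEquality.Core using (_≡_; _≢_)
open import Relation.Nullary.Decidable.Core using (_×-dec_)
open import Relation.Nullary.Negation.Core using (¬_)

IsMaximum : (ℕ → Set) → ℕ → Set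
IsMaximum P m = P m × (∀ k → P k → k ≤ m)

IsMinimum : (ℕ → Set) → ℕ → Set
IsMinimum P m = P m × (∀ k → P k → m ≤ k)

-- The vertex set is an arbitrary subset of an ambient Fin n, so that the
-- subgraphs of a graph are again of type Graph n.
record Graph (n : ℕ) : Set where
  field
    vertices : Subset n
    adj      : Fin n → Fin n → Bool

  infix 4 _~_
  _~_ : Fin n → Fin n → Set
  u ~ v = T (adj u v)

  field
    ~⇒∈    : ∀ {u v} → u ~ v → u ∈ vertices
    ~-sym  : ∀ {u v} → u ~ v → v ~ u
    ~-irrefl : ∀ {v} → ¬ (v ~ v)

open Graph public using (vertices)

module _ {n : ℕ} where

  -- Each undirected edge is listed once, smaller endpoint first.
  edges : Graph n → List (Fin n × Fin n)
  edges G = filter (λ (u , v) → (u Fin.<? v) ×-dec T? (adj u v))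
                   (cartesianProduct (allFin n) (allFin n))
    where open Graph G

  size : Graph n → ℕ
  size G = length (edges G)

  Nontrivial : Graph n → Set
  Nontrivial G = 2 ≤ ∣ vertices G ∣

  record _⊆ᴳ_ (H G : Graph n) : Set where
    field
      vertices-⊆ : vertices H ⊆ vertices G
      edges-⊆    : ∀ {u v} → Graph._~_ H u v → Graph._~_ G u v

  data Walk (G : Graph n) : Fin n → Fin n → Set where
    stop : ∀ {v} → v ∈ vertices G → Walk G v v
    step : ∀ {u v w} → Graph._~_ G u v → Walk G v w → Walk G u w

  module _ {G : Graph n} where

    visited : ∀ {u v} → Walk G u v → List (Fin n)
    visited (stop {v} _)   = v ∷ []
    visited (step {u} _ p) = u ∷ visited p

    walkLength : ∀ {u v} → Walk G u v → ℕ
    walkLength (stop _)   = 0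
    walkLength (step _ p) = suc (walkLength p)

  record Path (G : Graph n) (u v : Fin n) : Set where
    field
      walk   : Walk G u v
      unique : Unique (visited walk)

  pathLength : ∀ {G u v} → Path G u v → ℕ
  pathLength P = walkLength (Path.walk P)

  Connected : Graph n → Set
  Connected G = ∀ {u v} → u ∈ vertices G → v ∈ vertices G → Path G u v

  -- A cycle is a path with at least two edges together with an edge joining
  -- its ends.
  Acyclic : Graph n → Set
  Acyclic G = ∀ {u v} (P : Path G u v) → 2 ≤ pathLength P → ¬ Graph._~_ G v u

  record IsTree (G : Graph n) : Set where
    field
      nonempty  : Nonempty (vertices G)
      connected : Connected G
      acyclic   : Acyclic G

  IsDistance : (G : Graph n) (u v : Fin n) → ℕ → Set
  IsDistance G u v = IsMinimum (λ d → ∃[ P ] pathLength {G} {u} {v} P ≡ d)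

  IsDiameter : Graph n → ℕ → Set
  IsDiameter G = IsMaximum λ d →
    ∃[ u ] ∃[ v ] u ∈ vertices G × v ∈ vertices G × IsDistance G u v d

  IsSubtree : Graph n → Graph n → Set
  IsSubtree S G = S ⊆ᴳ G × IsTree S

  SubtreeOfDiameter : Graph n → ℕ → ℕ → Set
  SubtreeOfDiameter G D m = ∃[ S ] IsSubtree S G × IsDiameter S D × size S ≡ m

  SubtreeOfDiameterAtMost : Graph n → ℕ → ℕ → Set
  SubtreeOfDiameterAtMost G D m = ∃[ d ] d ≤ D × SubtreeOfDiameter G d m

  -- The colors given to non-adjacent pairs are irrelevant: only colors of
  -- edges are counted by numColors and read along walks.
  record EdgeColoring : Set where
    field
      color     : Fin n → Fin n → ℕ
      color-sym : ∀ u v → color u v ≡ color v u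

  open EdgeColoring

  numColors : Graph n → EdgeColoring → ℕ
  numColors G c = length (deduplicate ℕ._≟_ (map (λ (u , v) → color c u v) (edges G)))

  walkColors : ∀ {G u v} → EdgeColoring → Walk G u v → List ℕ
  walkColors c (stop _)           = []
  walkColors c (step {u} {v} _ p) = color c u v ∷ walkColors c p

  -- Between the edges at positions i < j of a path there are j ∸ suc i edges.
  DistanceProper : ∀ {G u v} → ℕ → EdgeColoring → Path G u v → Set
  DistanceProper ℓ c P =
    ∀ i j → i Fin.< j → lookup cs i ≡ lookup cs j → ¬ (toℕ j ∸ suc (toℕ i) < ℓ)
    where cs = walkColors c (Path.walk P)

  DistanceProperConnected : Graph n → ℕ → EdgeColoring → Set
  DistanceProperConnected G ℓ c =
    ∀ {u v} → u ∈ vertices G → v ∈ vertices G → u ≢ v →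
    ∃[ P ] DistanceProper {G} {u} {v} ℓ c P

  -- IsPC₁ G ℓ k means pc_{1,ℓ}(G) = k.
  IsPC₁ : Graph n → ℕ → ℕ → Set
  IsPC₁ G ℓ = IsMinimum λ k →
    ∃[ c ] DistanceProperConnected G ℓ c × numColors G c ≡ k

  -- G has no subtree of diameter D when its own diameter is smaller than D, and
  -- then the maximum over subtrees of diameter exactly D is over the empty set.
  -- "Diameter D" is therefore read as "diameter at most D", and the maximum over
  -- subtrees of diameter exactly D is asserted whenever there is one.
  IsMaxSubtreeSize : Graph n → ℕ → ℕ → Set
  IsMaxSubtreeSize G D k =
    ((∃[ m ] SubtreeOfDiameter G D m) → IsMaximum (SubtreeOfDiameter G D) k) ×
    IsMaximum (SubtreeOfDiameterAtMost G D) k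

{-# OPTIONS --safe #-}

-- In a tree, two edges lie on a common path with at most ℓ + 1 edges exactly
-- when their ends are pairwise at distance at most ℓ + 1, so a coloring is
-- distance ℓ-proper iff it separates all such pairs of edges.  In particular it
-- separates all edges of a subtree of diameter at most ℓ + 1, which is the lower
-- bound.  For the upper bound, root the tree at r and color the edges greedily by
-- increasing depth.  If v is the deeper end of an edge e, then e and the edges
-- conflicting with it that are already colored lie in the subtree S v spanned by
-- the vertices x with depth x ≤ depth v and dist v x ≤ ℓ + 1.  The four-point
-- condition
--   dist x y + depth v ≤ max (dist x v + depth y) (dist y v + depth x)
-- shows that S v has diameter at most ℓ + 1, so as many colors as the largest S v
-- has edges suffice.  If the largest S v has diameter at most ℓ, it spans the
-- tree, since otherwise one more edge could be added to it.
module Submission where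

open import Data.Bool.Base using (true; T; if_then_else_)
open import Data.Bool.Properties using (T?)
open import Data.Fin.Base as Fin using (Fin; zero; suc; toℕ)
import Data.Fin.Properties as Fin
open import Data.Fin.Subset using (Subset; _∈_; _∉_; _⊆_; Nonempty; _∪_; ⁅_⁆)
open import Data.Fin.Subset.Properties
  using (_∈?_; p⊆p∪q; q⊆p∪q; x∈p∪q⁻; x∈⁅x⁆; x∈⁅y⁆⇒x≡y)
open import Data.List.Base
  using (List; []; _∷_; _++_; length; map; filter; lookup; deduplicate; allFin; cartesianProduct; upTo)
open import Data.List.Extrema.Nat using (argmax; argmax-all; f[xs]≤f[argmax])
open import Data.List.Membership.Propositional using (find; lose) renaming (_∈_ to _∈ₗ_; _∉_ to _∉ₗ_)
open import Data.List.Membership.Propositional.Properties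
open import Data.List.Properties using (length-map; length-upTo; ∷-injective)
open import Data.List.Relation.Binary.Permutation.Propositional using (↭-sym; ↭⇒↭ₛ)
open import Data.List.Relation.Binary.Permutation.Propositional.Properties using (∈-resp-↭)
import Data.List.Relation.Binary.Permutation.Setoid.Properties as Permutation
open import Data.List.Relation.Binary.Subset.Propositional renaming (_⊆_ to _⊆ₗ_)
open import Data.List.Relation.Unary.All as All using (All; []; _∷_)
import Data.List.Relation.Unary.All.Properties as All
open import Data.List.Relation.Unary.AllPairs using (AllPairs; []; _∷_)
open import Data.List.Relation.Unary.Any as Any using (here; there)
open import Data.List.Relation.Unary.Any.Properties using (lookup-index)
open import Data.List.Relation.Unary.Sorted.TotalOrder.Properties using (Sorted⇒AllPairs)
open import Data.List.Relation.Unary.Unique.DecPropositional.Properties using (deduplicate-!)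
open import Data.List.Relation.Unary.Unique.Propositional using (Unique)
import Data.List.Relation.Unary.Unique.Propositional.Properties as Unique
import Data.List.Sort as Sort
open import Data.Nat.Base using (ℕ; zero; suc; _+_; _∸_; _≤_; _<_; z≤n; s≤s; _⊔_)
import Data.Nat.Properties as ℕ
open import Data.Product.Base using (∃-syntax; _×_; _,_; proj₁; proj₂)
open import Data.Product.Properties using (≡-dec)
open import Data.Sum.Base using (_⊎_; inj₁; inj₂; [_,_]′)
open import Data.Vec.Base using (tabulate)
open import Data.Vec.Properties using ([]=⇒lookup; lookup⇒[]=; lookup∘tabulate)
open import Function.Base using (_∘_; id; case_of_)
open import Relation.Binary.Bundles using (DecTotalOrder)
import Relation.Binary.Construct.Flip.EqAndOrd as Flip
import Relation.Binary.Construct.On as On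
open import Relation.Binary.Definitions using (Decidable; DecidableEquality; tri<; tri≈; tri>)
open import Relation.Binary.PropositionalEquality
  using (_≡_; _≢_; refl; sym; trans; cong; cong₂; subst; subst₂; setoid; module ≡-Reasoning)
open import Relation.Nullary using (¬_; Dec; yes; no; contradiction)
open import Relation.Nullary.Decidable
  using (⌊_⌋; toWitness; fromWitness; _×-dec_; ¬?; decidable-stable)
import Relation.Unary as U
open import Defs

-- Counting with lists without repetitions

lookup-injective : ∀ {A : Set} {xs : List A} → Unique xs → ∀ i j → lookup xs i ≡ lookup xs j → i ≡ j
lookup-injective (_  ∷ _) zero    zero    _  = refl
lookup-injective (px ∷ _) zero    (suc j) eq = contradiction eq (All.lookup px (∈-lookup j))
lookup-injective (px ∷ _) (suc i) zero    eq = contradiction (sym eq) (All.lookup px (∈-lookup i))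
lookup-injective (_  ∷ u) (suc i) (suc j) eq = cong suc (lookup-injective u i j eq)

-- Pigeonhole: each index of `xs` goes to the position in `ys` of its image, which is an injection
-- between finite sets. Injectivity is asked on the members only, since a coloring separates just
-- the edges of a small subtree.
injectiveOn⇒length≤ : ∀ {A B : Set} (f : A → B) {xs ys} → Unique xs →
                      (∀ {x} → x ∈ₗ xs → f x ∈ₗ ys) →
                      (∀ {x y} → x ∈ₗ xs → y ∈ₗ xs → f x ≡ f y → x ≡ y) →
                      length xs ≤ length ys
injectiveOn⇒length≤ f {xs} {ys} xs! f∈ f-inj = Fin.injective⇒≤ {f = position} position-injective
  where
  position : Fin (length xs) → Fin (length ys)
  position i = Any.index (f∈ (∈-lookup i))

  lookup-position : ∀ i → f (lookup xs i) ≡ lookup ys (position i)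
  lookup-position i = lookup-index (f∈ (∈-lookup i))

  position-injective : ∀ {i j} → position i ≡ position j → i ≡ j
  position-injective {i} {j} eq = lookup-injective xs! i j (f-inj (∈-lookup i) (∈-lookup j)
    (trans (lookup-position i) (trans (cong (lookup ys) eq) (sym (lookup-position j)))))

Unique-⊆⇒length≤ : ∀ {A : Set} {xs ys : List A} → Unique xs → xs ⊆ₗ ys → length xs ≤ length ys
Unique-⊆⇒length≤ xs! xs⊆ys = injectiveOn⇒length≤ id xs! xs⊆ys (λ _ _ → id)

∉⇒Unique-∷ : ∀ {A : Set} {x : A} {xs} → x ∉ₗ xs → Unique xs → Unique (x ∷ xs)
∉⇒Unique-∷ {x = x} x∉ u = All.tabulate (λ y∈ x≡y → x∉ (subst (_∈ₗ _) (sym x≡y) y∈)) ∷ u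

-- Walks and paths

module _ {n : ℕ} {G : Graph n} where

  open Graph G using (_~_; ~⇒∈; ~-sym)

  start∈ : ∀ {u v} → Walk G u v → u ∈ vertices G
  start∈ (stop v∈)    = v∈
  start∈ (step u~v _) = ~⇒∈ u~v

  end∈ : ∀ {u v} → Walk G u v → v ∈ vertices G
  end∈ (stop v∈)  = v∈
  end∈ (step _ p) = end∈ p

  start∈visited : ∀ {u v} (p : Walk G u v) → u ∈ₗ visited p
  start∈visited (stop _)   = here refl
  start∈visited (step _ _) = here refl

  end∈visited : ∀ {u v} (p : Walk G u v) → v ∈ₗ visited p
  end∈visited (stop _)   = here refl
  end∈visited (step _ p) = there (end∈visited p)

  visited⊆vertices : ∀ {u v x} (p : Walk G u v) → x ∈ₗ visited p → x ∈ vertices G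
  visited⊆vertices (stop v∈)    (here refl) = v∈
  visited⊆vertices (step u~v _) (here refl) = ~⇒∈ u~v
  visited⊆vertices (step _ p)   (there x∈)  = visited⊆vertices p x∈

  length-visited : ∀ {u v} (p : Walk G u v) → length (visited p) ≡ suc (walkLength p)
  length-visited (stop _)   = refl
  length-visited (step _ p) = cong suc (length-visited p)

  visited-head : ∀ {u v u′ v′} (p : Walk G u v) (q : Walk G u′ v′) →
                 visited p ≡ visited q → u ≡ u′
  visited-head (stop _)   (stop _)   eq = proj₁ (∷-injective eq)
  visited-head (stop _)   (step _ _) eq = proj₁ (∷-injective eq)
  visited-head (step _ _) (stop _)   eq = proj₁ (∷-injective eq)
  visited-head (step _ _) (step _ _) eq = proj₁ (∷-injective eq)

  append : ∀ {u v w} → Walk G u v → Walk G v w → Walk G u w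
  append (stop _)   q = q
  append (step e p) q = step e (append p q)

  walkLength-append : ∀ {u v w} (p : Walk G u v) (q : Walk G v w) →
                      walkLength (append p q) ≡ walkLength p + walkLength q
  walkLength-append (stop _)   q = refl
  walkLength-append (step _ p) q = cong suc (walkLength-append p q)

  visited-append : ∀ {u v w} (p : Walk G u v) (q : Walk G v w) →
                   visited (append p q) ⊆ₗ visited p ++ visited q
  visited-append (stop _)   q = there
  visited-append (step _ p) q (here refl) = here refl
  visited-append (step _ p) q (there x∈)  = there (visited-append p q x∈)

  visited-append-step : ∀ {u v v′ w} (p : Walk G u v) (v~v′ : v ~ v′) (q : Walk G v′ w) →
                        visited (append p (step v~v′ q)) ≡ visited p ++ visited q
  visited-append-step (stop _)   e q = refl
  visited-append-step (step _ p) e q = cong (_ ∷_) (visited-append-step p e q)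

  reverse : ∀ {u v} → Walk G u v → Walk G v u
  reverse (stop v∈)  = stop v∈
  reverse (step e p) = append (reverse p) (step (~-sym e) (stop (~⇒∈ e)))

  walkLength-reverse : ∀ {u v} (p : Walk G u v) → walkLength (reverse p) ≡ walkLength p
  walkLength-reverse (stop _)   = refl
  walkLength-reverse (step e p) =
    trans (walkLength-append (reverse p) _) (trans (ℕ.+-comm _ 1) (cong suc (walkLength-reverse p)))

  visited-reverse : ∀ {u v} (p : Walk G u v) → visited (reverse p) ⊆ₗ visited p
  visited-reverse (stop _)   x∈ = x∈
  visited-reverse (step e p) x∈
    rewrite visited-append-step (reverse p) (~-sym e) (stop (~⇒∈ e))
    with ∈-++⁻ (visited (reverse p)) x∈
  ... | inj₁ x∈p       = there (visited-reverse p x∈p)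
  ... | inj₂ (here eq) = here eq

  -- The back part carries the uniqueness because loop erasure keeps it; the front part serves only
  -- through its length.
  record Split {u w} (p : Walk G u w) (v : Fin n) : Set where
    field
      front        : Walk G u v
      back         : Walk G v w
      total-length : walkLength front + walkLength back ≡ walkLength p
      back⊆        : visited back ⊆ₗ visited p
      back-unique  : Unique (visited p) → Unique (visited back)

  split : ∀ {u v w} (p : Walk G u w) → v ∈ₗ visited p → Split p v
  split (stop v∈) (here refl) = record
    { front = stop v∈ ; back = stop v∈ ; total-length = refl ; back⊆ = id ; back-unique = id }
  split (step e p) (here refl) = record
    { front = stop (~⇒∈ e) ; back = step e p ; total-length = refl ; back⊆ = id ; back-unique = id }
  split (step e p) (there v∈) = record
    { front = step e front ; back = back ; total-length = cong suc total-length
    ; back⊆ = there ∘ back⊆ ; back-unique = λ { (_ ∷ u) → back-unique u } }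
    where open Split (split p v∈)

  record Shortcut {u v} (p : Walk G u v) : Set where
    field
      path    : Path G u v
      shorter : pathLength path ≤ walkLength p
      path⊆   : visited (Path.walk path) ⊆ₗ visited p

  -- Loop erasure from the far end: if `u` recurs on the path already extracted from the rest of the
  -- walk, everything before that recurrence is dropped.
  shortcut : ∀ {u v} (p : Walk G u v) → Shortcut p
  shortcut (stop v∈) = record
    { path = record { walk = stop v∈ ; unique = [] ∷ [] } ; shorter = z≤n ; path⊆ = id }
  shortcut (step {u} e p) with shortcut p
  ... | record { path = P ; shorter = P≤p ; path⊆ = P⊆p } with Any.any? (u Fin.≟_) (visited (Path.walk P))
  ...   | no u∉ = record
          { path    = record { walk = step e (Path.walk P) ; unique = ∉⇒Unique-∷ u∉ (Path.unique P) }
          ; shorter = s≤s P≤p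
          ; path⊆   = λ { (here eq) → here eq ; (there x∈) → there (P⊆p x∈) } }
  ...   | yes u∈ = record
          { path    = record { walk = back ; unique = back-unique (Path.unique P) }
          ; shorter = ℕ.m≤n⇒m≤1+n (ℕ.≤-trans (ℕ.m+n≤o⇒n≤o (walkLength front) (ℕ.≤-reflexive total-length)) P≤p)
          ; path⊆   = there ∘ P⊆p ∘ back⊆ }
          where open Split (split (Path.walk P) u∈)

  -- Two paths that leave u for distinct neighbours x and y and meet again
  -- yield a path from x to y avoiding u, which closes to a cycle through u.
  path-visited-unique : Acyclic G → ∀ {u w} (p q : Walk G u w) → Unique (visited p) → Unique (visited q) →
                        visited p ≡ visited q
  path-visited-unique acyc (stop _) (stop _) _ _ = refl
  path-visited-unique acyc (stop _) (step _ q) _ (u∉q ∷ _) =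
    contradiction refl (All.lookup u∉q (end∈visited q))
  path-visited-unique acyc (step _ p) (stop _) (u∉p ∷ _) _ =
    contradiction refl (All.lookup u∉p (end∈visited p))
  path-visited-unique acyc (step {u} {x} u~x p) (step {v = y} u~y q) (u∉p ∷ p!) (u∉q ∷ q!)
    with x Fin.≟ y
  ... | yes refl = cong (u ∷_) (path-visited-unique acyc p q p! q!)
  ... | no x≢y   = contradiction (~-sym u~y) (acyc cycle (s≤s (nonempty R)))
    where
    open Shortcut (shortcut (append p (reverse q))) renaming (path to R)

    u∉R : All (u ≢_) (visited (Path.walk R))
    u∉R = All.tabulate λ x∈R → case ∈-++⁻ (visited p) (visited-append p (reverse q) (path⊆ x∈R)) of λ where
      (inj₁ x∈p) → All.lookup u∉p x∈p
      (inj₂ x∈q) → All.lookup u∉q (visited-reverse q x∈q)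

    cycle : Path G u y
    cycle = record { walk = step u~x (Path.walk R) ; unique = u∉R ∷ Path.unique R }

    nonempty : (R : Path G x y) → 1 ≤ pathLength R
    nonempty record { walk = stop _ }   = contradiction refl x≢y
    nonempty record { walk = step _ _ } = s≤s z≤n

  pathLength-unique : Acyclic G → ∀ {u w} (P Q : Path G u w) → pathLength P ≡ pathLength Q
  pathLength-unique acyc P Q = ℕ.suc-injective (begin
    suc (pathLength P)          ≡⟨ length-visited (walk P) ⟨
    length (visited (walk P))   ≡⟨ cong length (path-visited-unique acyc (walk P) (walk Q) (unique P) (unique Q)) ⟩
    length (visited (walk Q))   ≡⟨ length-visited (walk Q) ⟩
    suc (pathLength Q)          ∎)
    where
    open ≡-Reasoning
    open Path

-- The path metric of a tree

module TreeMetric {n : ℕ} (T : Graph n) (isTree : IsTree T) where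

  open Graph T using (_~_; ~⇒∈; ~-sym; ~-irrefl)
  open IsTree isTree

  opaque

    -- 0 unless both arguments are vertices of T.
    dist : Fin n → Fin n → ℕ
    dist u v with u ∈? vertices T | v ∈? vertices T
    ... | yes u∈ | yes v∈ = pathLength (connected u∈ v∈)
    ... | yes _  | no _   = 0
    ... | no _   | _      = 0

    dist-path : ∀ {u v} (P : Path T u v) → dist u v ≡ pathLength P
    dist-path {u} {v} P with u ∈? vertices T | v ∈? vertices T
    ... | no u∉  | _      = contradiction (start∈ (Path.walk P)) u∉
    ... | yes _  | no v∉  = contradiction (end∈ (Path.walk P)) v∉
    ... | yes u∈ | yes v∈ = pathLength-unique acyclic (connected u∈ v∈) P

  -- Erasing loops gives a path no longer than the walk, and all paths between the same ends have
  -- equal length. The metric laws below follow by concatenating, reversing and extending walks.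
  dist≤walkLength : ∀ {u v} (p : Walk T u v) → dist u v ≤ walkLength p
  dist≤walkLength p = subst (_≤ walkLength p) (sym (dist-path path)) shorter
    where open Shortcut (shortcut p)

  dist-refl : ∀ {v} → v ∈ vertices T → dist v v ≡ 0
  dist-refl v∈ = ℕ.n≤0⇒n≡0 (dist≤walkLength (stop v∈))

  dist≡0⇒≡ : ∀ {u v} → u ∈ vertices T → v ∈ vertices T → dist u v ≡ 0 → u ≡ v
  dist≡0⇒≡ u∈ v∈ eq with connected u∈ v∈
  ... | record { walk = stop _ }     = refl
  ... | P@(record { walk = step _ _ }) = contradiction (trans (sym (dist-path P)) eq) λ ()

  dist-triangle : ∀ {u v w} → u ∈ vertices T → v ∈ vertices T → w ∈ vertices T →
                  dist u w ≤ dist u v + dist v w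
  dist-triangle {u} {v} {w} u∈ v∈ w∈ = begin
    dist u w                                     ≤⟨ dist≤walkLength (append p q) ⟩
    walkLength (append p q)                      ≡⟨ walkLength-append p q ⟩
    walkLength p + walkLength q                  ≡⟨ cong₂ _+_ (dist-path P) (dist-path Q) ⟨
    dist u v + dist v w                          ∎
    where
    open ℕ.≤-Reasoning
    P = connected u∈ v∈
    Q = connected v∈ w∈
    p = Path.walk P
    q = Path.walk Q

  dist-sym-≤ : ∀ {u v} → u ∈ vertices T → v ∈ vertices T → dist v u ≤ dist u v
  dist-sym-≤ {u} {v} u∈ v∈ = begin
    dist v u                ≤⟨ dist≤walkLength (reverse p) ⟩
    walkLength (reverse p)  ≡⟨ walkLength-reverse p ⟩
    walkLength p            ≡⟨ dist-path (connected u∈ v∈) ⟨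
    dist u v                ∎
    where
    open ℕ.≤-Reasoning
    p = Path.walk (connected u∈ v∈)

  dist-sym : ∀ {u v} → u ∈ vertices T → v ∈ vertices T → dist u v ≡ dist v u
  dist-sym u∈ v∈ = ℕ.≤-antisym (dist-sym-≤ v∈ u∈) (dist-sym-≤ u∈ v∈)

  dist-edge : ∀ {a b} → a ~ b → dist a b ≤ 1
  dist-edge a~b = dist≤walkLength (step a~b (stop (~⇒∈ (~-sym a~b))))

  dist-step : ∀ {a b c} → a ~ b → c ∈ vertices T → dist a c ≤ suc (dist b c)
  dist-step {a} {b} {c} a~b c∈ = subst (λ m → dist a c ≤ suc m) (sym (dist-path P))
    (dist≤walkLength (step a~b (Path.walk P)))
    where P = connected (~⇒∈ (~-sym a~b)) c∈

  dist-stepʳ : ∀ {a b c} → b ~ c → a ∈ vertices T → dist a c ≤ suc (dist a b)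
  dist-stepʳ {a} {b} {c} b~c a∈ = subst₂ (λ i j → i ≤ suc j) (dist-sym c∈ a∈) (dist-sym (~⇒∈ b~c) a∈)
    (dist-step (~-sym b~c) a∈)
    where c∈ = ~⇒∈ (~-sym b~c)

  -- The converse of the triangle inequality for a vertex on the path: both pieces of the path are
  -- walks.
  dist-split : ∀ {u v w} (P : Path T u w) → v ∈ₗ visited (Path.walk P) → dist u v + dist v w ≤ dist u w
  dist-split {u} {v} {w} P v∈ = begin
    dist u v + dist v w                ≤⟨ ℕ.+-mono-≤ (dist≤walkLength front) (dist≤walkLength back) ⟩
    walkLength front + walkLength back ≡⟨ total-length ⟩
    pathLength P                       ≡⟨ dist-path P ⟨
    dist u w                           ∎
    where
    open ℕ.≤-Reasoning
    open Split (split (Path.walk P) v∈)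

  -- The ends of an edge are never equally far from `c`. If the path from `b` to `c` misses `a`,
  -- prepending `a` gives the path from `a`; if it meets `a`, then `a` is nearer by at least one.
  dist-adjacent : ∀ {a b c} → a ~ b → c ∈ vertices T →
                  dist a c ≡ suc (dist b c) ⊎ dist b c ≡ suc (dist a c)
  dist-adjacent {a} {b} {c} a~b c∈ with Any.any? (a Fin.≟_) (visited (Path.walk P))
    where P = connected (~⇒∈ (~-sym a~b)) c∈
  ... | no a∉ = inj₁ (trans (dist-path aP) (cong suc (sym (dist-path P))))
    where
    P  = connected (~⇒∈ (~-sym a~b)) c∈
    aP = record { walk = step a~b (Path.walk P) ; unique = ∉⇒Unique-∷ a∉ (Path.unique P) }
  ... | yes a∈P = inj₂ (ℕ.≤-antisym (dist-step (~-sym a~b) c∈)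
    (ℕ.≤-trans (ℕ.+-monoˡ-≤ (dist a c) (ℕ.n≢0⇒n>0 b≢a)) (dist-split P a∈P)))
    where
    P = connected (~⇒∈ (~-sym a~b)) c∈
    b≢a : dist b a ≢ 0
    b≢a eq with refl ← dist≡0⇒≡ (~⇒∈ (~-sym a~b)) (~⇒∈ a~b) eq = ~-irrefl a~b

  -- For an edge from `a` to `b` this says that the path from `a` to `c` starts with that edge. The
  -- target comes first, then the farther end, then the nearer one.
  Closer : Fin n → Fin n → Fin n → Set
  Closer c a b = dist a c ≡ suc (dist b c)

  closer-path : ∀ {a b c} → a ~ b → (c∈ : c ∈ vertices T) (b∈ : b ∈ vertices T) → Closer c a b →
                Unique (a ∷ visited (Path.walk (connected b∈ c∈)))
  closer-path {a} {b} {c} a~b c∈ b∈ b-closer = ∉⇒Unique-∷ a∉ (Path.unique P)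
    where
    P = connected b∈ c∈
    a∉ : a ∉ₗ visited (Path.walk P)
    a∉ a∈P = ℕ.n≮n (dist b c) (begin
      suc (dist b c)      ≡⟨ b-closer ⟨
      dist a c            ≤⟨ ℕ.m≤n+m _ _ ⟩
      dist b a + dist a c ≤⟨ dist-split P a∈P ⟩
      dist b c            ∎)
      where open ℕ.≤-Reasoning

  -- Both neighbours extend to paths from `a` to `c`; these coincide in a tree, so their second
  -- vertices agree.
  closer-unique : ∀ {a b b′ c} → c ∈ vertices T → a ~ b → a ~ b′ → Closer c a b → Closer c a b′ → b ≡ b′
  closer-unique c∈ a~b a~b′ closer closer′ = visited-head p q (proj₂ (∷-injective
    (path-visited-unique acyclic (step a~b p) (step a~b′ q)
      (closer-path a~b c∈ b∈ closer) (closer-path a~b′ c∈ b′∈ closer′))))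
    where
    b∈  = ~⇒∈ (~-sym a~b)
    b′∈ = ~⇒∈ (~-sym a~b′)
    p = Path.walk (connected b∈ c∈)
    q = Path.walk (connected b′∈ c∈)

  closer-exists : ∀ {a c} → a ∈ vertices T → c ∈ vertices T → a ≢ c → ∃[ b ] a ~ b × Closer c a b
  closer-exists a∈ c∈ a≢c with connected a∈ c∈
  ... | record { walk = stop _ } = contradiction refl a≢c
  ... | P@(record { walk = step {v = b} a~b p ; unique = _ ∷ p! }) =
    b , a~b , trans (dist-path P) (cong suc (sym (dist-path (record { walk = p ; unique = p! }))))

  -- Vertices between `x` and `a` lie on the side of `a`: if `z` were at least as near to `b`, going
  -- through `z` would take `x` to `b` in at most `dist x a` steps, but `b` is one farther.
  closer-between : ∀ {a b x z} → a ~ b → x ∈ vertices T → z ∈ vertices T → Closer x b a →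
                   dist x z + dist z a ≤ dist x a → dist z a < dist z b
  closer-between {a} {b} {x} {z} a~b x∈ z∈ closer z-between = ℕ.+-cancelˡ-≤ (dist x z) _ _ (begin
    dist x z + suc (dist z a)    ≡⟨ ℕ.+-suc (dist x z) _ ⟩
    suc (dist x z + dist z a)    ≤⟨ s≤s z-between ⟩
    suc (dist x a)               ≡⟨ cong suc (dist-sym x∈ (~⇒∈ a~b)) ⟩
    suc (dist a x)               ≡⟨ closer ⟨
    dist b x                     ≡⟨ dist-sym b∈ x∈ ⟩
    dist x b                     ≤⟨ dist-triangle x∈ z∈ b∈ ⟩
    dist x z + dist z b          ∎)
    where
    open ℕ.≤-Reasoning
    b∈ = ~⇒∈ (~-sym a~b)

  -- Removing the edge ab separates x from y.
  dist-across : ∀ {a b x y} → a ~ b → x ∈ vertices T → y ∈ vertices T → Closer x b a → Closer y a b →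
                dist x y ≡ dist x a + suc (dist b y)
  dist-across {a} {b} {x} {y} a~b x∈ y∈ closer-x closer-y = begin
    dist x y                                               ≡⟨ dist-path PQ ⟩
    walkLength (append (walk P) (step a~b (walk Q)))       ≡⟨ walkLength-append (walk P) _ ⟩
    walkLength (walk P) + suc (walkLength (walk Q))        ≡⟨ cong₂ (λ i j → i + suc j) (dist-path P) (dist-path Q) ⟨
    dist x a + suc (dist b y)                              ∎
    where
    open ≡-Reasoning
    open Path using (walk; unique)
    a∈ = ~⇒∈ a~b
    b∈ = ~⇒∈ (~-sym a~b)
    P = connected x∈ a∈
    Q = connected b∈ y∈

    y-between : ∀ {z} → z ∈ vertices T → dist b z + dist z y ≤ dist b y → dist y z + dist z b ≤ dist y b
    y-between {z} z∈ = subst₂ _≤_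
      (trans (ℕ.+-comm (dist b z) _) (cong₂ _+_ (dist-sym z∈ y∈) (dist-sym b∈ z∈))) (dist-sym b∈ y∈)

    -- A vertex on both halves would be strictly nearer to `a` than to `b` and also the other way
    -- round.
    disjoint : ∀ {z} → ¬ (z ∈ₗ visited (walk P) × z ∈ₗ visited (walk Q))
    disjoint {z} (z∈P , z∈Q) = ℕ.<-asym
      (closer-between a~b x∈ z∈ closer-x (dist-split P z∈P))
      (closer-between (~-sym a~b) y∈ z∈ closer-y (y-between z∈ (dist-split Q z∈Q)))
      where z∈ = visited⊆vertices (walk P) z∈P

    PQ : Path T x y
    PQ = record
      { walk   = append (walk P) (step a~b (walk Q))
      ; unique = subst Unique (sym (visited-append-step (walk P) a~b (walk Q)))
                   (Unique.++⁺ (unique P) (unique Q) disjoint)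
      }

  -- Induction along the path from `v` to `r`, whose next vertex is `w`. If `x` or `y` is on the
  -- side of `v`, its path to `r` passes through `v` and the triangle inequality suffices. If both
  -- are on the side of `w`, replacing `v` by `w` lowers both sides by one. At `v = r` the claim is
  -- the triangle inequality.
  four-point : ∀ {x y v r} → x ∈ vertices T → y ∈ vertices T → v ∈ vertices T → r ∈ vertices T →
               dist x y + dist v r ≤ (dist x v + dist y r) ⊔ (dist y v + dist x r)
  four-point {x} {y} {v} {r} x∈ y∈ v∈ r∈ = go (dist v r) v v∈ refl
    where
    Bound : Fin n → Fin n → Fin n → ℕ
    Bound x y v = dist x v + dist y r

    across : ∀ {x y v w} → x ∈ vertices T → y ∈ vertices T → v ∈ vertices T → v ~ w → Closer r v w → Closer x w v →
             dist x y + dist v r ≤ dist y v + dist x r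
    across {x} {y} {v} {w} x∈ y∈ v∈ v~w w-closer v-closer = begin
      dist x y + dist v r                      ≤⟨ ℕ.+-monoˡ-≤ (dist v r) (dist-triangle x∈ v∈ y∈) ⟩
      dist x v + dist v y + dist v r           ≡⟨ cong₂ _+_ (ℕ.+-comm (dist x v) _) w-closer ⟩
      dist v y + dist x v + suc (dist w r)     ≡⟨ ℕ.+-assoc (dist v y) _ _ ⟩
      dist v y + (dist x v + suc (dist w r))   ≡⟨ cong₂ _+_ (dist-sym v∈ y∈) (sym xr) ⟩
      dist y v + dist x r                      ∎
      where
      open ℕ.≤-Reasoning
      xr = dist-across v~w x∈ r∈ v-closer w-closer

    go : ∀ m v → v ∈ vertices T → dist v r ≡ m → dist x y + dist v r ≤ Bound x y v ⊔ Bound y x v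
    go zero v v∈ eq with refl ← dist≡0⇒≡ v∈ r∈ eq = ℕ.m≤n⇒m≤n⊔o _ (begin
      dist x y + dist r r ≡⟨ cong (dist x y +_) eq ⟩
      dist x y + 0        ≡⟨ ℕ.+-identityʳ _ ⟩
      dist x y            ≤⟨ dist-triangle x∈ r∈ y∈ ⟩
      dist x r + dist r y ≡⟨ cong (dist x r +_) (dist-sym r∈ y∈) ⟩
      dist x r + dist y r ∎)
      where open ℕ.≤-Reasoning
    go (suc m) v v∈ eq with closer-exists v∈ r∈ (λ { refl → ℕ.0≢1+n (trans (sym (dist-refl v∈)) eq) })
    ... | w , v~w , w-closer with dist-adjacent v~w x∈ | dist-adjacent v~w y∈
    ...   | inj₂ v-closer | _ = ℕ.m≤n⇒m≤o⊔n _ (across x∈ y∈ v∈ v~w w-closer v-closer)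
    ...   | _ | inj₂ v-closer = ℕ.m≤n⇒m≤n⊔o _
      (subst (λ i → i + dist v r ≤ Bound x y v) (dist-sym y∈ x∈) (across y∈ x∈ v∈ v~w w-closer v-closer))
    ...   | inj₁ x-side | inj₁ y-side = begin
      dist x y + dist v r                              ≡⟨ cong (dist x y +_) w-closer ⟩
      dist x y + suc (dist w r)                        ≡⟨ ℕ.+-suc (dist x y) _ ⟩
      suc (dist x y + dist w r)                        ≤⟨ s≤s (go m w w∈ wr≡m) ⟩
      suc (Bound x y w) ⊔ suc (Bound y x w)            ≡⟨ cong₂ _⊔_ (farther y x∈ x-side) (farther x y∈ y-side) ⟩
      Bound x y v ⊔ Bound y x v                        ∎
      where
      open ℕ.≤-Reasoning
      w∈ = ~⇒∈ (~-sym v~w)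
      wr≡m = ℕ.suc-injective (trans (sym w-closer) eq)

      farther : ∀ {x} y → x ∈ vertices T → Closer x v w → suc (Bound x y w) ≡ Bound x y v
      farther {x} y x∈ closer =
        cong (_+ dist y r) (trans (cong suc (dist-sym x∈ w∈)) (trans (sym closer) (dist-sym v∈ x∈)))

-- Greedy coloring

-- If every number below `k` occurred in `cs`, the pigeonhole principle would give `k ≤ length cs`.
fresh : ∀ {k} (cs : List ℕ) → length cs < k → ∃[ c ] c < k × c ∉ₗ cs
fresh {k} cs cs<k with Any.any? (λ c → ¬? (Any.any? (c ℕ.≟_) cs)) (upTo k)
... | yes free = let c , c∈ , c∉ = find free in c , ∈-upTo⁻ c∈ , c∉
... | no ¬free = contradiction k≤cs (ℕ.<⇒≱ cs<k)
  where
  k≤cs : k ≤ length cs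
  k≤cs = subst (_≤ length cs) (length-upTo k) (Unique-⊆⇒length≤ (Unique.upTo⁺ k)
    λ {c} c∈ → decidable-stable (Any.any? (c ℕ.≟_) cs) (λ c∉ → ¬free (lose c∈ c∉)))

AllPairs-lookup : ∀ {A : Set} {R : A → A → Set} {xs x y} → AllPairs R xs → x ∈ₗ xs → y ∈ₗ xs →
                  x ≢ y → R x y ⊎ R y x
AllPairs-lookup (_  ∷ _)  (here refl) (here refl) x≢y = contradiction refl x≢y
AllPairs-lookup (px ∷ _)  (here refl) (there y∈)  _   = inj₁ (All.lookup px y∈)
AllPairs-lookup (py ∷ _)  (there x∈)  (here refl) _   = inj₂ (All.lookup py x∈)
AllPairs-lookup (_  ∷ ps) (there x∈)  (there y∈)  x≢y = AllPairs-lookup ps x∈ y∈ x≢y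

module _ {A : Set} {Conflict : A → A → Set} (conflict? : Decidable Conflict) (k : ℕ) where

  -- A degeneracy order of the conflict graph: when the list is colored from its end, each element
  -- meets fewer than `k` colored conflicts.
  data Degenerate : List A → Set where
    []  : Degenerate []
    _∷_ : ∀ {x xs} → length (filter (conflict? x) xs) < k → Degenerate xs → Degenerate (x ∷ xs)

  -- The tail is colored first; the head then gets a color below `k` that none of its conflicts in
  -- the tail uses.
  greedy-coloring : DecidableEquality A → ∀ {xs} → Unique xs → Degenerate xs →
                    ∃[ f ] All (λ x → f x < k) xs × AllPairs (λ x y → Conflict x y → f x ≢ f y) xs
  greedy-coloring _ [] [] = (λ _ → 0) , [] , []
  greedy-coloring _≟_ {x ∷ xs} (x∉ ∷ xs!) (few ∷ deg)
    with f , f<k , proper ← greedy-coloring _≟_ xs! deg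
    with c , c<k , c∉ ← fresh (map f (filter (conflict? x) xs))
           (subst (_< k) (sym (length-map f (filter (conflict? x) xs))) few)
    = g , subst (_< k) (sym g-x) c<k ∷ All.tabulate (λ y∈ → subst (_< k) (sym (g-xs y∈)) (All.lookup f<k y∈))
        , All.tabulate proper-x ∷ proper-xs proper id
    where
    g : A → ℕ
    g y = if ⌊ x ≟ y ⌋ then c else f y

    g-x : g x ≡ c
    g-x with x ≟ x
    ... | yes _  = refl
    ... | no x≢x = contradiction refl x≢x

    g-xs : ∀ {y} → y ∈ₗ xs → g y ≡ f y
    g-xs {y} y∈ with x ≟ y
    ... | yes x≡y = contradiction x≡y (All.lookup x∉ y∈)
    ... | no _    = refl

    proper-x : ∀ {y} → y ∈ₗ xs → Conflict x y → g x ≢ g y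
    proper-x {y} y∈ xy gx≡gy = c∉ (subst (_∈ₗ _) (trans (sym (g-xs y∈)) (trans (sym gx≡gy) g-x))
      (∈-map⁺ f (∈-filter⁺ (conflict? x) y∈ xy)))

    proper-xs : ∀ {ys} → AllPairs (λ y z → Conflict y z → f y ≢ f z) ys → ys ⊆ₗ xs →
                           AllPairs (λ y z → Conflict y z → g y ≢ g z) ys
    proper-xs [] _ = []
    proper-xs (ps ∷ pss) ys⊆ =
      All.tabulate (λ z∈ yz → subst₂ _≢_
        (sym (g-xs (ys⊆ (here refl)))) (sym (g-xs (ys⊆ (there z∈)))) (All.lookup ps z∈ yz))
      ∷ proper-xs pss (ys⊆ ∘ there)

-- Vertex subsets, undirected edges and induced subgraphs

module _ {n : ℕ} {P : Fin n → Set} (P? : U.Decidable P) where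

  comprehension : Subset n
  comprehension = tabulate (λ x → ⌊ P? x ⌋)

  ∈-comprehension⁺ : ∀ {x} → P x → x ∈ comprehension
  ∈-comprehension⁺ {x} px = lookup⇒[]= x _ (trans (lookup∘tabulate _ x) (holds px))
    where
    holds : P x → ⌊ P? x ⌋ ≡ true
    holds px with P? x
    ... | yes _  = refl
    ... | no ¬px = contradiction px ¬px

  ∈-comprehension⁻ : ∀ {x} → x ∈ comprehension → P x
  ∈-comprehension⁻ {x} x∈ with P? x | trans (sym (lookup∘tabulate (λ x → ⌊ P? x ⌋) x)) ([]=⇒lookup x∈)
  ... | yes px | _  = px
  ... | no _   | ()

module _ {n : ℕ} where

  opaque

    -- The representative under which `edges` lists an undirected edge. A coloring that factors
    -- through it is symmetric.
    orient : Fin n → Fin n → Fin n × Fin n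
    orient u v = if ⌊ u Fin.<? v ⌋ then (u , v) else (v , u)

    orient-< : ∀ {u v} → u Fin.< v → orient u v ≡ (u , v)
    orient-< {u} {v} u<v with u Fin.<? v
    ... | yes _  = refl
    ... | no u≮v = contradiction u<v u≮v

    orient-sym : ∀ u v → orient u v ≡ orient v u
    orient-sym u v with u Fin.<? v | v Fin.<? u
    ... | yes u<v | yes v<u = contradiction v<u (Fin.<-asym u<v)
    ... | yes _   | no _    = refl
    ... | no _    | yes _   = refl
    ... | no u≮v  | no v≮u with Fin.<-cmp u v
    ...   | tri< u<v _ _  = contradiction u<v u≮v
    ...   | tri≈ _ refl _ = refl
    ...   | tri> _ _ v<u  = contradiction v<u v≮u

    orient-cases : ∀ u v → orient u v ≡ (u , v) ⊎ orient u v ≡ (v , u)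
    orient-cases u v with u Fin.<? v
    ... | yes _ = inj₁ refl
    ... | no _  = inj₂ refl

module _ {n : ℕ} (G : Graph n) where

  open Graph G using (adj; _~_; ~-sym; ~-irrefl)

  ∈-edges⁺ : ∀ {u v} → u Fin.< v → u ~ v → (u , v) ∈ₗ edges G
  ∈-edges⁺ u<v u~v = ∈-filter⁺ _ (∈-cartesianProduct⁺ (∈-allFin _) (∈-allFin _)) (u<v , u~v)

  ∈-edges⁻ : ∀ {u v} → (u , v) ∈ₗ edges G → u Fin.< v × u ~ v
  ∈-edges⁻ uv∈ = proj₂ (∈-filter⁻ (λ (u , v) → (u Fin.<? v) ×-dec T? (adj u v))
    {xs = cartesianProduct (allFin n) (allFin n)} uv∈)

  edges-unique : Unique (edges G)
  edges-unique = Unique.filter⁺ _ (Unique.cartesianProduct⁺ (Unique.allFin⁺ n) (Unique.allFin⁺ n))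

  orient-∈-edges : ∀ {u v} → u ~ v → orient u v ∈ₗ edges G
  orient-∈-edges {u} {v} u~v with Fin.<-cmp u v
  ... | tri< u<v _ _  = subst (_∈ₗ _) (sym (orient-< u<v)) (∈-edges⁺ u<v u~v)
  ... | tri≈ _ refl _ = contradiction u~v ~-irrefl
  ... | tri> _ _ v<u  = subst (_∈ₗ _) (sym (trans (orient-sym u v) (orient-< v<u))) (∈-edges⁺ v<u (~-sym u~v))

  inducedEdge? : (X : Subset n) (u v : Fin n) → Dec (u ~ v × u ∈ X × v ∈ X)
  inducedEdge? X u v = T? (adj u v) ×-dec u ∈? X ×-dec v ∈? X

  induced : Subset n → Graph n
  induced X = record
    { vertices = X
    ; adj      = λ u v → ⌊ inducedEdge? X u v ⌋
    ; ~⇒∈      = λ {u} {v} e → proj₁ (proj₂ (toWitness {a? = inducedEdge? X u v} e))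
    ; ~-sym    = λ {u} {v} e → let u~v , u∈ , v∈ = toWitness {a? = inducedEdge? X u v} e
                               in fromWitness {a? = inducedEdge? X v u} (~-sym u~v , v∈ , u∈)
    ; ~-irrefl = λ {v} e → ~-irrefl (proj₁ (toWitness {a? = inducedEdge? X v v} e))
    }

  induced-~⁺ : ∀ {X u v} → u ~ v → u ∈ X → v ∈ X → Graph._~_ (induced X) u v
  induced-~⁺ {X} {u} {v} u~v u∈ v∈ = fromWitness {a? = inducedEdge? X u v} (u~v , u∈ , v∈)

  induced-~⁻ : ∀ {X u v} → Graph._~_ (induced X) u v → u ~ v × u ∈ X × v ∈ X
  induced-~⁻ {X} {u} {v} = toWitness {a? = inducedEdge? X u v}

  induced-⊆ : ∀ {X} → X ⊆ vertices G → induced X ⊆ᴳ G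
  induced-⊆ {X} X⊆ = record { vertices-⊆ = X⊆ ; edges-⊆ = proj₁ ∘ induced-~⁻ {X} }

-- Distance proper colorings of a tree

open EdgeColoring

SameEdge : ∀ {n} → (a b x y : Fin n) → Set
SameEdge a b x y = (a ≡ x × b ≡ y) ⊎ (a ≡ y × b ≡ x)

SameEdge-swapˡ : ∀ {n} {a b x y : Fin n} → SameEdge a b x y → SameEdge b a x y
SameEdge-swapˡ (inj₁ (a≡x , b≡y)) = inj₂ (b≡y , a≡x)
SameEdge-swapˡ (inj₂ (a≡y , b≡x)) = inj₁ (b≡x , a≡y)

SameEdge-swapʳ : ∀ {n} {a b x y : Fin n} → SameEdge a b y x → SameEdge a b x y
SameEdge-swapʳ (inj₁ same) = inj₂ same
SameEdge-swapʳ (inj₂ same) = inj₁ same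

SameEdge-orient : ∀ {n} {a b x y : Fin n} → orient a b ≡ orient x y → SameEdge a b x y
SameEdge-orient {a = a} {b} {x} {y} eq with orient-cases a b | orient-cases x y
... | inj₁ ab | inj₁ xy with refl ← trans (sym ab) (trans eq xy) = inj₁ (refl , refl)
... | inj₁ ab | inj₂ yx with refl ← trans (sym ab) (trans eq yx) = inj₂ (refl , refl)
... | inj₂ ba | inj₁ xy with refl ← trans (sym ba) (trans eq xy) = inj₂ (refl , refl)
... | inj₂ ba | inj₂ yx with refl ← trans (sym ba) (trans eq yx) = inj₁ (refl , refl)

module _ {n : ℕ} {G : Graph n} (c : EdgeColoring {n}) where

  open Graph G using (_~_; ~⇒∈; ~-sym)

  -- The walk `front` turns a position on the walk into a bound on distances; the two memberships
  -- tell the edge apart from one that has an end off the walk.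
  record EdgeAt {u v} (p : Walk G u v) (i : Fin (length (walkColors c p))) : Set where
    field
      {tail head}   : Fin n
      tail~head     : tail ~ head
      color-at      : lookup (walkColors c p) i ≡ color c tail head
      front         : Walk G u tail
      front-length  : walkLength front ≡ toℕ i
      tail∈visited  : tail ∈ₗ visited p
      head∈visited  : head ∈ₗ visited p

  edgeAt : ∀ {u v} (p : Walk G u v) (i : Fin (length (walkColors c p))) → EdgeAt p i
  edgeAt (step e p) zero = record
    { tail~head = e ; color-at = refl ; front = stop (~⇒∈ e) ; front-length = refl
    ; tail∈visited = here refl ; head∈visited = there (start∈visited p) }
  edgeAt (step e p) (suc i) = record
    { tail~head = tail~head ; color-at = color-at ; front = step e front ; front-length = cong suc front-length
    ; tail∈visited = there tail∈visited ; head∈visited = there head∈visited }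
    where open EdgeAt (edgeAt p i)

  record LastEdge {u v} (p : Walk G u v) : Set where
    field
      {penultimate} : Fin n
      last-edge     : penultimate ~ v
      position      : Fin (length (walkColors c p))
      color-last    : lookup (walkColors c p) position ≡ color c penultimate v
      front         : Walk G u penultimate
      front-length  : walkLength front ≡ toℕ position
      last-position : walkLength p ≡ suc (toℕ position)

  lastEdge : ∀ {u v w} (e : u ~ v) (p : Walk G v w) → LastEdge (step e p)
  lastEdge e (stop _) = record
    { last-edge = e ; position = zero ; color-last = refl ; front = stop (~⇒∈ e)
    ; front-length = refl ; last-position = refl }
  lastEdge e (step e′ p) = record
    { last-edge = last-edge ; position = suc position ; color-last = color-last ; front = step e front
    ; front-length = cong suc front-length ; last-position = cong suc last-position }
    where open LastEdge (lastEdge e′ p)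

module TreeColoring {n : ℕ} (T : Graph n) (isTree : IsTree T) (ℓ : ℕ) where

  open Graph T using (_~_; ~⇒∈; ~-sym)
  open TreeMetric T isTree

  ~⇒∈ʳ : ∀ {u v} → u ~ v → v ∈ vertices T
  ~⇒∈ʳ u~v = ~⇒∈ (~-sym u~v)

  -- The conflict relation on edges. The bound `suc ℓ` counts the at most `ℓ - 1` edges in between
  -- together with the two edges themselves.
  Close : Fin n × Fin n → Fin n × Fin n → Set
  Close (a , b) (x , y) = (dist a x ≤ suc ℓ × dist a y ≤ suc ℓ) × (dist b x ≤ suc ℓ × dist b y ≤ suc ℓ)

  close? : Decidable Close
  close? (a , b) (x , y) =
    (dist a x ℕ.≤? suc ℓ ×-dec dist a y ℕ.≤? suc ℓ) ×-dec (dist b x ℕ.≤? suc ℓ ×-dec dist b y ℕ.≤? suc ℓ)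

  ProperOnClose : EdgeColoring → Set
  ProperOnClose c = ∀ {a b x y} → a ~ b → x ~ y → Close (a , b) (x , y) →
                    color c a b ≡ color c x y → SameEdge a b x y

  properOnClose⇒distanceProper : ∀ {c u v} → ProperOnClose c → (P : Path T u v) → DistanceProper ℓ c P
  properOnClose⇒distanceProper {c} proper record { walk = p ; unique = p! } = along p p!
    where
    along : ∀ {u v} (p : Walk T u v) → Unique (visited p) → ∀ i j → i Fin.< j →
            lookup (walkColors c p) i ≡ lookup (walkColors c p) j → ¬ (toℕ j ∸ suc (toℕ i) < ℓ)
    -- Dropping the first edge shifts both positions and keeps the number of edges in between.
    along (step e p) (_ ∷ p!) (suc i) (suc j) (s≤s i<j) eq j-i<ℓ = along p p! i j i<j eq j-i<ℓ
    -- Exactly `j` edges lie in between, and `front` is a walk of length `j` from `x` to `tail`,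
    -- which bounds all four distances. The edges differ because the path never returns to `u`.
    along (step {u} {x} u~x p) (u∉p ∷ _) zero (suc j) _ eq j<ℓ =
      u∉edge (proper u~x tail~head ((ℕ.m≤n⇒m≤1+n u-tail , u-head) , (ℕ.m≤n⇒m≤1+n x-tail , ℕ.m≤n⇒m≤1+n x-head))
        (trans eq color-at))
      where
      open EdgeAt (edgeAt c p j)

      x-tail : dist x tail ≤ ℓ
      x-tail = ℕ.≤-trans (dist≤walkLength front) (ℕ.≤-trans (ℕ.≤-reflexive front-length) (ℕ.<⇒≤ j<ℓ))

      x-head : dist x head ≤ ℓ
      x-head = ℕ.≤-trans (dist-stepʳ tail~head (~⇒∈ʳ u~x))
        (ℕ.≤-trans (s≤s (dist≤walkLength front)) (subst (λ m → suc m ≤ ℓ) (sym front-length) j<ℓ))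

      u-tail : dist u tail ≤ ℓ
      u-tail = ℕ.≤-trans (dist≤walkLength (step u~x front)) (subst (λ m → suc m ≤ ℓ) (sym front-length) j<ℓ)

      u-head : dist u head ≤ suc ℓ
      u-head = ℕ.≤-trans (dist-stepʳ tail~head (~⇒∈ u~x)) (s≤s u-tail)

      u∉edge : ¬ SameEdge u x tail head
      u∉edge (inj₁ (u≡tail , _)) = All.lookup u∉p tail∈visited u≡tail
      u∉edge (inj₂ (u≡head , _)) = All.lookup u∉p head∈visited u≡head

  module _ {c : EdgeColoring} (connect : DistanceProperConnected T ℓ c) where

    -- The two edges are the first and the last one of the path from `a` to `x`. Either that path is
    -- a single edge and they coincide, or fewer than `ℓ` edges separate them and the properness of
    -- the path forbids equal colors.
    properOnClose-extremal : ∀ {a b x y} → a ~ b → x ~ y → dist a x ≤ suc ℓ → color c a b ≡ color c x y →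
                             Closer x a b → Closer a x y → SameEdge a b x y
    properOnClose-extremal {a} {b} {x} {y} a~b x~y ax≤ eq b-closer y-closer
      with connect a∈ x∈ (λ { refl → ℕ.0≢1+n (trans (sym (dist-refl a∈)) b-closer) })
      where
      a∈ = ~⇒∈ a~b
      x∈ = ~⇒∈ x~y
    ... | record { walk = stop a∈ } , _ = contradiction (trans (sym (dist-refl a∈)) b-closer) ℕ.0≢1+n
    ... | P@(record { walk = step a~b′ q ; unique = _ ∷ q! }) , proper
      -- The path supplied by `connect` leaves `a` towards `x`, hence through `b`.
      with refl ← closer-unique (~⇒∈ x~y) a~b a~b′ b-closer
                    (trans (dist-path P) (cong suc (sym (dist-path (record { walk = q ; unique = q! })))))
      with q | dist-path P | proper
    ... | stop _ | ax | _ = inj₂ (sym (dist≡0⇒≡ (~⇒∈ʳ x~y) (~⇒∈ a~b) ya≡0) , refl)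
      where ya≡0 = ℕ.suc-injective (trans (sym y-closer) (trans (dist-sym (~⇒∈ x~y) (~⇒∈ a~b)) ax))
    ... | step b~z r | ax | proper = contradiction position<ℓ
            (proper zero (suc position) (s≤s z≤n)
              (trans eq (trans (color-sym c x y) (trans (cong (λ z → color c z x) (sym z≡y)) (sym color-last)))))
      where
      open LastEdge (lastEdge c b~z r)
      open ℕ.≤-Reasoning
      a∈ = ~⇒∈ a~b
      x∈ = ~⇒∈ x~y
      z∈ = ~⇒∈ last-edge

      ax-length : dist a x ≡ suc (suc (toℕ position))
      ax-length = trans ax (cong suc last-position)

      -- The whole path has `position + 2` edges, of which `position` lie between the first and the
      -- last.
      position<ℓ : suc (toℕ position) ≤ ℓ
      position<ℓ = ℕ.≤-pred (subst (_≤ suc ℓ) ax-length ax≤)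

      z-closer : Closer a x penultimate
      z-closer = ℕ.≤-antisym (dist-step (~-sym last-edge) a∈) (begin
        suc (dist penultimate a)             ≡⟨ cong suc (dist-sym z∈ a∈) ⟩
        suc (dist a penultimate)             ≤⟨ s≤s (dist≤walkLength (step a~b front)) ⟩
        suc (suc (walkLength front))         ≡⟨ cong (2 +_) front-length ⟩
        suc (suc (toℕ position))             ≡⟨ ax-length ⟨
        dist a x                             ≡⟨ dist-sym a∈ x∈ ⟩
        dist x a                             ∎)

      z≡y : penultimate ≡ y
      z≡y = closer-unique a∈ (~-sym last-edge) x~y z-closer y-closer

    -- The end of the second edge farther from `a` is taken as the far end of the path, so that both
    -- edges become extremal.
    properOnClose-oriented : ∀ {a b x y} → a ~ b → x ~ y → dist a x ≤ suc ℓ → dist a y ≤ suc ℓ →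
                             color c a b ≡ color c x y → Closer x a b → SameEdge a b x y
    properOnClose-oriented {a} {b} {x} {y} a~b x~y ax≤ ay≤ eq b-closer with dist-adjacent x~y (~⇒∈ a~b)
    ... | inj₁ y-closer = properOnClose-extremal a~b x~y ax≤ eq b-closer y-closer
    ... | inj₂ x-closer with dist-adjacent a~b (~⇒∈ʳ x~y)
    ...   | inj₁ b-closer-to-y = SameEdge-swapʳ
            (properOnClose-extremal a~b (~-sym x~y) ay≤ (trans eq (color-sym c x y)) b-closer-to-y x-closer)
    -- Here `b` would be three farther from `y` than from `x`, although `x ~ y`.
    ...   | inj₂ a-closer-to-y = contradiction (begin-strict
            suc (dist b x)              <⟨ ℕ.m<n⇒m<1+n ℕ.≤-refl ⟩
            suc (suc (suc (dist b x)))  ≡⟨ cong (2 +_) b-closer ⟨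
            suc (suc (dist a x))        ≡⟨ cong (2 +_) (dist-sym a∈ x∈) ⟩
            suc (suc (dist x a))        ≡⟨ cong suc x-closer ⟨
            suc (dist y a)              ≡⟨ cong suc (dist-sym y∈ a∈) ⟩
            suc (dist a y)              ≡⟨ a-closer-to-y ⟨
            dist b y                    ≤⟨ dist-stepʳ x~y (~⇒∈ʳ a~b) ⟩
            suc (dist b x)              ∎) (ℕ.n≮n _)
      where
      open ℕ.≤-Reasoning
      a∈ = ~⇒∈ a~b
      x∈ = ~⇒∈ x~y
      y∈ = ~⇒∈ʳ x~y

    distanceProper⇒properOnClose : ProperOnClose c
    distanceProper⇒properOnClose {a} {b} {x} {y} a~b x~y ((ax , ay) , (bx , by)) eq
      with dist-adjacent a~b (~⇒∈ x~y)
    ... | inj₁ b-closer = properOnClose-oriented a~b x~y ax ay eq b-closer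
    ... | inj₂ a-closer = SameEdge-swapˡ
          (properOnClose-oriented (~-sym a~b) x~y bx by (trans (color-sym c b a) eq) a-closer)

-- Walks and acyclicity in subgraphs

open _⊆ᴳ_

module _ {n : ℕ} {S G : Graph n} (S⊆G : S ⊆ᴳ G) where

  embed : ∀ {u v} → Walk S u v → Walk G u v
  embed (stop v∈)  = stop (vertices-⊆ S⊆G v∈)
  embed (step e p) = step (edges-⊆ S⊆G e) (embed p)

  visited-embed : ∀ {u v} (p : Walk S u v) → visited (embed p) ≡ visited p
  visited-embed (stop _)   = refl
  visited-embed (step _ p) = cong (_ ∷_) (visited-embed p)

  walkLength-embed : ∀ {u v} (p : Walk S u v) → walkLength (embed p) ≡ walkLength p
  walkLength-embed (stop _)   = refl
  walkLength-embed (step _ p) = cong suc (walkLength-embed p)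

  embedPath : ∀ {u v} → Path S u v → Path G u v
  embedPath P = record { walk = embed walk ; unique = subst Unique (sym (visited-embed walk)) unique }
    where open Path P

  acyclic-⊆ : Acyclic G → Acyclic S
  acyclic-⊆ acyclic P 2≤P v~u = acyclic (embedPath P)
    (subst (2 ≤_) (sym (walkLength-embed (Path.walk P))) 2≤P) (edges-⊆ S⊆G v~u)

-- Bounded subtrees

module Extremal {n : ℕ} (T : Graph n) (isTree : IsTree T) (ℓ : ℕ) where

  open Graph T using (_~_; ~⇒∈; ~-sym)
  open IsTree isTree
  open TreeMetric T isTree
  open TreeColoring T isTree ℓ

  -- A path of `S` is also a path of `T`, where paths are unique; so distances in a connected
  -- subgraph are those of `T`.
  dist-pathLength : ∀ {S u v} → S ⊆ᴳ T → (P : Path S u v) → pathLength P ≡ dist u v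
  dist-pathLength S⊆T P = trans (sym (walkLength-embed S⊆T (Path.walk P))) (sym (dist-path (embedPath S⊆T P)))

  isDistance-dist : ∀ {S u v} → S ⊆ᴳ T → Path S u v → IsDistance S u v (dist u v)
  isDistance-dist S⊆T P = (P , dist-pathLength S⊆T P) ,
    λ { _ (Q , refl) → ℕ.≤-reflexive (sym (dist-pathLength S⊆T Q)) }

  module _ {S : Graph n} (S⊆T : S ⊆ᴳ T) {δ : ℕ} (isDiameter : IsDiameter S δ) where

    diameter-attained : ∃[ u ] ∃[ v ] u ∈ vertices S × v ∈ vertices S × dist u v ≡ δ
    diameter-attained with u , v , u∈ , v∈ , (P , eq) , _ ← proj₁ isDiameter =
      u , v , u∈ , v∈ , trans (sym (dist-pathLength S⊆T P)) eq

    dist≤diameter : Connected S → ∀ {u v} → u ∈ vertices S → v ∈ vertices S → dist u v ≤ δ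
    dist≤diameter connectedS u∈ v∈ =
      proj₂ isDiameter _ (_ , _ , u∈ , v∈ , isDistance-dist S⊆T (connectedS u∈ v∈))

  members : Subset n → List (Fin n)
  members X = filter (_∈? X) (allFin n)

  ∈-members⁺ : ∀ {X x} → x ∈ X → x ∈ₗ members X
  ∈-members⁺ {X} x∈ = ∈-filter⁺ (_∈? X) (∈-allFin _) x∈

  members-∈ : ∀ X → All (_∈ X) (members X)
  members-∈ X = All.all-filter (_∈? X) (allFin n)

  diameter-exists : ∀ {S} → S ⊆ᴳ T → Nonempty (vertices S) → Connected S → ∃[ δ ] IsDiameter S δ
  diameter-exists {S} S⊆T (r , r∈) connectedS = _ , (u , v , u∈ , v∈ , isDistance-dist S⊆T (connectedS u∈ v∈)) ,
    λ { _ (x , y , x∈ , y∈ , (P , refl) , _) →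
        subst (_≤ span (u , v)) (sym (dist-pathLength S⊆T P))
          (All.lookup (f[xs]≤f[argmax] {f = span} (r , r) pairs)
            (∈-cartesianProduct⁺ (∈-members⁺ x∈) (∈-members⁺ y∈))) }
    where
    pairs : List (Fin n × Fin n)
    pairs = cartesianProduct (members (vertices S)) (members (vertices S))

    span : Fin n × Fin n → ℕ
    span (u , v) = dist u v

    farthest : Fin n × Fin n
    farthest = argmax span (r , r) pairs

    u = proj₁ farthest
    v = proj₂ farthest

    farthest∈ : u ∈ vertices S × v ∈ vertices S
    farthest∈ = argmax-all span (r∈ , r∈) (All.cartesianProduct⁺ (setoid _) (setoid _) _ _ λ x∈ y∈ →
      All.lookup (members-∈ _) x∈ , All.lookup (members-∈ _) y∈)

    u∈ = proj₁ farthest∈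
    v∈ = proj₂ farthest∈

  Bounded : Subset n → Set
  Bounded X = ∀ {x y} → x ∈ X → y ∈ X → dist x y ≤ suc ℓ

  -- Any two edges of `S` are close, so the coloring is injective on them.
  size≤numColors : ∀ {S c} → S ⊆ᴳ T → Bounded (vertices S) → ProperOnClose c → size S ≤ numColors T c
  size≤numColors {S} {c} S⊆T bounded proper =
    injectiveOn⇒length≤ edgeColor (edges-unique S) used injective
    where
    open Graph S using () renaming (_~_ to _~ₛ_; ~⇒∈ to ~ₛ⇒∈; ~-sym to ~ₛ-sym)

    edgeColor : Fin n × Fin n → ℕ
    edgeColor (u , v) = color c u v

    used : ∀ {e} → e ∈ₗ edges S → edgeColor e ∈ₗ deduplicate ℕ._≟_ (map edgeColor (edges T))
    used {u , v} e∈ = let u<v , u~v = ∈-edges⁻ S e∈ in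
      ∈-deduplicate⁺ ℕ._≟_ (∈-map⁺ edgeColor (∈-edges⁺ T u<v (edges-⊆ S⊆T u~v)))

    injective : ∀ {e f} → e ∈ₗ edges S → f ∈ₗ edges S → edgeColor e ≡ edgeColor f → e ≡ f
    injective {a , b} {x , y} e∈ f∈ eq with ∈-edges⁻ S e∈ | ∈-edges⁻ S f∈
    ... | a<b , a~b | x<y , x~y
      with proper (edges-⊆ S⊆T a~b) (edges-⊆ S⊆T x~y)
             ((bounded a∈ x∈ , bounded a∈ y∈) , (bounded b∈ x∈ , bounded b∈ y∈)) eq
      where
      a∈ = ~ₛ⇒∈ a~b
      b∈ = ~ₛ⇒∈ (~ₛ-sym a~b)
      x∈ = ~ₛ⇒∈ x~y
      y∈ = ~ₛ⇒∈ (~ₛ-sym x~y)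
    ...   | inj₁ (refl , refl) = refl
    -- Both edges are listed with the smaller end first, so neither is the reverse of the other.
    ...   | inj₂ (refl , refl) = contradiction x<y (Fin.<-asym a<b)

  numColors≤ : ∀ {c k} → (∀ {u v} → u ~ v → color c u v < k) → numColors T c ≤ k
  numColors≤ {c} {k} bound = subst (numColors T c ≤_) (length-upTo k)
    (Unique-⊆⇒length≤ (deduplicate-! ℕ._≟_ colors) λ z∈ →
      let e , e∈ , eq = ∈-map⁻ (λ (u , v) → color c u v) (∈-deduplicate⁻ ℕ._≟_ colors z∈)
      in ∈-upTo⁺ (subst (_< k) (sym eq) (bound (proj₂ (∈-edges⁻ T e∈)))))
    where colors = map (λ (u , v) → color c u v) (edges T)

  -- Shallow balls in the rooted tree

  root : Fin n
  root = proj₁ nonempty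

  root∈ : root ∈ vertices T
  root∈ = proj₂ nonempty

  depth : Fin n → ℕ
  depth v = dist v root

  -- The vertex set of `S v`. The depth condition brings the diameter down from twice the radius to
  -- the radius `suc ℓ`.
  InShallowBall : Fin n → Fin n → Set
  InShallowBall v x = x ∈ vertices T × depth x ≤ depth v × dist v x ≤ suc ℓ

  inShallowBall? : ∀ v → U.Decidable (InShallowBall v)
  inShallowBall? v x = x ∈? vertices T ×-dec depth x ℕ.≤? depth v ×-dec dist v x ℕ.≤? suc ℓ

  opaque

    shallowBall : Fin n → Subset n
    shallowBall v = comprehension (inShallowBall? v)

    ∈-shallowBall⁺ : ∀ {v x} → InShallowBall v x → x ∈ shallowBall v
    ∈-shallowBall⁺ {v} = ∈-comprehension⁺ (inShallowBall? v)

    ∈-shallowBall⁻ : ∀ {v x} → x ∈ shallowBall v → InShallowBall v x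
    ∈-shallowBall⁻ {v} = ∈-comprehension⁻ (inShallowBall? v)

  shallowBall⊆ : ∀ {v} → shallowBall v ⊆ vertices T
  shallowBall⊆ {v} x∈ = proj₁ (∈-shallowBall⁻ x∈)

  centre∈shallowBall : ∀ {v} → v ∈ vertices T → v ∈ shallowBall v
  centre∈shallowBall {v} v∈ = ∈-shallowBall⁺ (v∈ , ℕ.≤-refl , subst (_≤ suc ℓ) (sym (dist-refl v∈)) z≤n)

  -- In the four-point condition with the root, both terms on the right are at most
  -- `suc ℓ + depth v`, and `depth v` cancels.
  shallowBall-bounded : ∀ {v} → v ∈ vertices T → Bounded (shallowBall v)
  shallowBall-bounded {v} v∈ {x} {y} x∈ball y∈ball
    with x∈ , dx≤dv , vx≤ ← ∈-shallowBall⁻ x∈ball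
    with y∈ , dy≤dv , vy≤ ← ∈-shallowBall⁻ y∈ball =
    ℕ.+-cancelʳ-≤ (depth v) _ _ (ℕ.≤-trans (four-point x∈ y∈ v∈ root∈) (ℕ.⊔-lub
      (ℕ.+-mono-≤ (subst (_≤ suc ℓ) (dist-sym v∈ x∈) vx≤) dy≤dv)
      (ℕ.+-mono-≤ (subst (_≤ suc ℓ) (dist-sym v∈ y∈) vy≤) dx≤dv)))

  shallowTree : Fin n → Graph n
  shallowTree v = induced T (shallowBall v)

  shallowTree⊆ : ∀ v → shallowTree v ⊆ᴳ T
  shallowTree⊆ v = induced-⊆ T (shallowBall⊆ {v})

  -- Moving one step towards `v` stays in the ball: the distance to `v` drops and the depth does not
  -- exceed that of `v`.
  walkToCentre : ∀ {v} → v ∈ vertices T → ∀ m {x} → dist x v ≡ m → x ∈ shallowBall v → Walk (shallowTree v) x v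
  walkToCentre {v} v∈ m {x} xv x∈ball with x Fin.≟ v | ∈-shallowBall⁻ x∈ball
  ... | yes refl | _ = stop x∈ball
  walkToCentre {v} v∈ zero {x} xv _ | no x≢v | x∈ , _ = contradiction (dist≡0⇒≡ x∈ v∈ xv) x≢v
  walkToCentre {v} v∈ (suc m) {x} xv x∈ball | no x≢v | x∈ , dx≤dv , vx≤
    with w , x~w , w-closer ← closer-exists x∈ v∈ x≢v =
    step (induced-~⁺ T x~w x∈ball w∈ball) (walkToCentre v∈ m (ℕ.suc-injective (trans (sym w-closer) xv)) w∈ball)
    where
    open ℕ.≤-Reasoning
    w∈ = ~⇒∈ʳ x~w

    dw≤dv : depth w ≤ depth v
    dw≤dv with dist-adjacent x~w root∈
    ... | inj₁ dx≡ = ℕ.≤-trans (ℕ.≤-trans (ℕ.n≤1+n _) (ℕ.≤-reflexive (sym dx≡))) dx≤dv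
    -- The step leads away from the root, so its edge separates `v` from the root and `w` lies on
    -- the path from `v` to the root.
    ... | inj₂ dw≡ = begin
      depth w                       ≡⟨ dw≡ ⟩
      suc (depth x)                 ≤⟨ ℕ.m≤n+m _ _ ⟩
      dist v w + suc (depth x)      ≡⟨ dist-across (~-sym x~w) v∈ root∈ w-closer dw≡ ⟨
      depth v                       ∎

    w∈ball : w ∈ shallowBall v
    w∈ball = ∈-shallowBall⁺ (w∈ , dw≤dv , (begin
      dist v w        ≡⟨ dist-sym v∈ w∈ ⟩
      dist w v        ≤⟨ ℕ.n≤1+n _ ⟩
      suc (dist w v)  ≡⟨ w-closer ⟨
      dist x v        ≡⟨ dist-sym x∈ v∈ ⟩
      dist v x        ≤⟨ vx≤ ⟩
      suc ℓ           ∎))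

  shallowTree-isTree : ∀ {v} → v ∈ vertices T → IsTree (shallowTree v)
  shallowTree-isTree {v} v∈ = record
    { nonempty  = v , centre∈shallowBall v∈
    ; connected = connect
    ; acyclic   = acyclic-⊆ {S = shallowTree v} (shallowTree⊆ v) acyclic
    }

    where
    connect : Connected (shallowTree v)
    connect {x} {y} x∈ y∈ = Shortcut.path (shortcut (append {G = shallowTree v}
      (walkToCentre v∈ (dist x v) refl x∈) (reverse (walkToCentre v∈ (dist y v) refl y∈))))

  opaque

    largest : Fin n
    largest = argmax (size ∘ shallowTree) root (members (vertices T))

    largest∈ : largest ∈ vertices T
    largest∈ = argmax-all (size ∘ shallowTree) root∈ (members-∈ (vertices T))

    -- The common value in the theorem: the least number of colors and the largest size of a
    -- subtree.
    maxSize : ℕ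
    maxSize = size (shallowTree largest)

    size-largest : size (shallowTree largest) ≡ maxSize
    size-largest = refl

    size-shallowTree≤ : ∀ {v} → v ∈ vertices T → size (shallowTree v) ≤ maxSize
    size-shallowTree≤ v∈ =
      All.lookup (f[xs]≤f[argmax] {f = size ∘ shallowTree} root (members (vertices T))) (∈-members⁺ v∈)

  -- The greedy order of the edges

  edgeDepth : Fin n × Fin n → ℕ
  edgeDepth (u , v) = depth u ⊔ depth v

  DeepEnd : Fin n × Fin n → Fin n → Set
  DeepEnd (a , b) v = (v ≡ a ⊎ v ≡ b) × depth a ⊔ depth b ≡ depth v

  deepEnd : ∀ e → ∃[ v ] DeepEnd e v
  deepEnd (a , b) with ℕ.⊔-sel (depth a) (depth b)
  ... | inj₁ a-deeper = a , inj₁ refl , a-deeper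
  ... | inj₂ b-deeper = b , inj₂ refl , b-deeper

  deepEnd∈ : ∀ {e v} → e ∈ₗ edges T → DeepEnd e v → v ∈ vertices T
  deepEnd∈ e∈ (inj₁ refl , _) = ~⇒∈ (proj₂ (∈-edges⁻ T e∈))
  deepEnd∈ e∈ (inj₂ refl , _) = ~⇒∈ʳ (proj₂ (∈-edges⁻ T e∈))

  close-refl : ∀ {e} → e ∈ₗ edges T → Close e e
  close-refl {a , b} e∈ = (vertex a∈ , edge a~b) , (edge (~-sym a~b) , vertex b∈)
    where
    a~b = proj₂ (∈-edges⁻ T e∈)
    a∈  = ~⇒∈ a~b
    b∈  = ~⇒∈ʳ a~b

    vertex : ∀ {x} → x ∈ vertices T → dist x x ≤ suc ℓ
    vertex x∈ = subst (_≤ suc ℓ) (sym (dist-refl x∈)) z≤n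

    edge : ∀ {x y} → x ~ y → dist x y ≤ suc ℓ
    edge x~y = ℕ.≤-trans (dist-edge x~y) (s≤s z≤n)

  -- Since `v` is an end of `e`, closeness puts the ends of `f` within `suc ℓ` of `v`; since it is
  -- the deeper end, they are no deeper than `v`.
  close⇒∈-shallowTree : ∀ {e f v} → DeepEnd e v → f ∈ₗ edges T → edgeDepth f ≤ edgeDepth e → Close e f →
                      f ∈ₗ edges (shallowTree v)
  close⇒∈-shallowTree {a , b} {x , y} {v} (v-end , v-depth) f∈ f≤e close@((ax , ay) , (bx , by)) =
    ∈-edges⁺ (shallowTree v) x<y (induced-~⁺ T {X = shallowBall v} x~y
      (∈-shallowBall⁺ (~⇒∈ x~y , ℕ.m⊔n≤o⇒m≤o _ _ f≤v , from-end ax bx))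
      (∈-shallowBall⁺ (~⇒∈ʳ x~y , ℕ.m⊔n≤o⇒n≤o (depth x) _ f≤v , from-end ay by)))
    where
    x<y = proj₁ (∈-edges⁻ T f∈)
    x~y = proj₂ (∈-edges⁻ T f∈)

    f≤v : edgeDepth (x , y) ≤ depth v
    f≤v = subst (edgeDepth (x , y) ≤_) v-depth f≤e

    from-end : ∀ {z} → dist a z ≤ suc ℓ → dist b z ≤ suc ℓ → dist v z ≤ suc ℓ
    from-end {z} az bz = [ (λ v≡a → subst (λ u → dist u z ≤ suc ℓ) (sym v≡a) az)
                         , (λ v≡b → subst (λ u → dist u z ≤ suc ℓ) (sym v≡b) bz) ]′ v-end

  -- The order is reversed because the greedy coloring starts at the end of the list: shallow edges
  -- are colored first.
  deepFirst : DecTotalOrder _ _ _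
  deepFirst = On.decTotalOrder (Flip.decTotalOrder ℕ.≤-decTotalOrder) edgeDepth

  open Sort deepFirst using (sort; sort-↭; sort-↗)

  sortedEdges : List (Fin n × Fin n)
  sortedEdges = sort (edges T)

  sortedEdges-unique : Unique sortedEdges
  sortedEdges-unique = Permutation.Unique-resp-↭ (setoid _) (↭⇒↭ₛ (↭-sym (sort-↭ (edges T)))) (edges-unique T)

  sortedEdges-sorted : AllPairs (λ e f → edgeDepth f ≤ edgeDepth e) sortedEdges
  sortedEdges-sorted = Sorted⇒AllPairs (DecTotalOrder.totalOrder deepFirst) (sort-↗ (edges T))

  -- An edge and its conflicts later in the list are distinct edges of one shallow tree. Counting
  -- the edge itself makes the bound strict.
  degenerate : ∀ {es} → Unique es → AllPairs (λ e f → edgeDepth f ≤ edgeDepth e) es → es ⊆ₗ edges T →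
               Degenerate close? maxSize es
  degenerate [] [] _ = []
  degenerate {e ∷ es} (e∉ ∷ es!) (e-deepest ∷ sorted) es⊆ = few ∷ degenerate es! sorted (es⊆ ∘ there)
    where
    e∈ = es⊆ (here refl)
    v = proj₁ (deepEnd e)
    v-end = proj₂ (deepEnd e)

    conflicts⊆ : e ∷ filter (close? e) es ⊆ₗ edges (shallowTree v)
    conflicts⊆ (here refl) = close⇒∈-shallowTree v-end e∈ ℕ.≤-refl (close-refl e∈)
    conflicts⊆ (there f∈)  = let f∈es , close = ∈-filter⁻ (close? e) f∈ in
      close⇒∈-shallowTree v-end (es⊆ (there f∈es)) (All.lookup e-deepest f∈es) close

    few : length (filter (close? e) es) < maxSize
    few = ℕ.≤-trans
      (Unique-⊆⇒length≤ (All.filter⁺ (close? e) e∉ ∷ Unique.filter⁺ (close? e) es!) conflicts⊆)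
      (size-shallowTree≤ (deepEnd∈ e∈ v-end))

  -- The optimal coloring

  close-sym : ∀ {a b x y} → a ~ b → x ~ y → Close (a , b) (x , y) → Close (x , y) (a , b)
  close-sym a~b x~y ((ax , ay) , (bx , by)) = (flip a∈ x∈ ax , flip b∈ x∈ bx) , (flip a∈ y∈ ay , flip b∈ y∈ by)
    where
    a∈ = ~⇒∈ a~b
    b∈ = ~⇒∈ʳ a~b
    x∈ = ~⇒∈ x~y
    y∈ = ~⇒∈ʳ x~y
    flip : ∀ {u v} → u ∈ vertices T → v ∈ vertices T → dist u v ≤ suc ℓ → dist v u ≤ suc ℓ
    flip u∈ v∈ = subst (_≤ suc ℓ) (dist-sym u∈ v∈)

  close-orientʳ : ∀ {e x y} → Close e (x , y) → Close e (orient x y)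
  close-orientʳ {_} {x} {y} close@((ax , ay) , (bx , by)) with orient-cases x y
  ... | inj₁ eq = subst (Close _) (sym eq) close
  ... | inj₂ eq = subst (Close _) (sym eq) ((ay , ax) , (by , bx))

  close-orientˡ : ∀ {a b f} → Close (a , b) f → Close (orient a b) f
  close-orientˡ {a} {b} {f} close@(a-close , b-close) with orient-cases a b
  ... | inj₁ eq = subst (λ e → Close e f) (sym eq) close
  ... | inj₂ eq = subst (λ e → Close e f) (sym eq) (b-close , a-close)

  maxSize≤numColors : ∀ {c} → ProperOnClose c → maxSize ≤ numColors T c
  maxSize≤numColors {c} proper = subst (_≤ numColors T c) size-largest
    (size≤numColors {shallowTree largest} {c} (shallowTree⊆ largest) (shallowBall-bounded largest∈) proper)

  orientedColoring : (Fin n × Fin n → ℕ) → EdgeColoring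
  orientedColoring f = record { color = λ u v → f (orient u v) ; color-sym = λ u v → cong f (orient-sym u v) }

  opaque

    -- The greedy colors are below `maxSize`, and the largest shallow tree forces that many colors.
    optimal-coloring : ∃[ c ] ProperOnClose c × numColors T c ≡ maxSize
    optimal-coloring
      with f , f< , f-proper ← greedy-coloring close? maxSize (≡-dec Fin._≟_ Fin._≟_) sortedEdges-unique
             (degenerate sortedEdges-unique sortedEdges-sorted (∈-resp-↭ (sort-↭ (edges T))))
      = orientedColoring f , proper , ℕ.≤-antisym
          (numColors≤ {orientedColoring f} λ u~v → All.lookup f< (∈-sorted u~v))
          (maxSize≤numColors {orientedColoring f} proper)
      where
      ∈-sorted : ∀ {u v} → u ~ v → orient u v ∈ₗ sortedEdges
      ∈-sorted u~v = ∈-resp-↭ (↭-sym (sort-↭ (edges T))) (orient-∈-edges T u~v)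

      proper : ProperOnClose (orientedColoring f)
      proper {a} {b} {x} {y} a~b x~y close eq with ≡-dec Fin._≟_ Fin._≟_ (orient a b) (orient x y)
      ... | yes same = SameEdge-orient same
      -- The greedy coloring separates close edges in list order; either edge may come first, hence
      -- the appeal to `close-sym`.
      ... | no ab≢xy with AllPairs-lookup f-proper (∈-sorted a~b) (∈-sorted x~y) ab≢xy
      ...   | inj₁ differ = contradiction eq (differ (close-orientˡ (close-orientʳ {_} {x} {y} close)))
      ...   | inj₂ differ = contradiction (sym eq)
              (differ (close-orientˡ {x} {y} (close-orientʳ {_} {a} {b} (close-sym a~b x~y close))))

  -- Maximality comes from the coloring: its `maxSize` colors must be distinct on the edges of `S`.
  bounded⇒size≤ : ∀ {S} → S ⊆ᴳ T → Bounded (vertices S) → size S ≤ maxSize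
  bounded⇒size≤ {S} S⊆T bounded with c , proper , eq ← optimal-coloring =
    subst (size S ≤_) eq (size≤numColors {S} {c} S⊆T bounded proper)

  diameter⇒bounded : ∀ {S δ} → IsSubtree S T → IsDiameter S δ → δ ≤ suc ℓ → Bounded (vertices S)
  diameter⇒bounded (S⊆T , isTreeS) isDiameter δ≤ x∈ y∈ =
    ℕ.≤-trans (dist≤diameter S⊆T isDiameter (IsTree.connected isTreeS) x∈ y∈) δ≤

  isPC₁ : IsPC₁ T ℓ maxSize
  isPC₁ with c , proper , eq ← optimal-coloring =
    (c , (λ u∈ v∈ _ → connected u∈ v∈ , properOnClose⇒distanceProper {c} proper (connected u∈ v∈)) , eq) ,
    λ { _ (c′ , connect , refl) → maxSize≤numColors {c′} (distanceProper⇒properOnClose {c′} connect) }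

  -- The largest subtree and its diameter

  largestTree-isSubtree : IsSubtree (shallowTree largest) T
  largestTree-isSubtree = shallowTree⊆ largest , shallowTree-isTree largest∈

  opaque

    largestTree-diameter : ∃[ δ ] δ ≤ suc ℓ × IsDiameter (shallowTree largest) δ
    largestTree-diameter
      with δ , isDiameter ← diameter-exists {shallowTree largest} (shallowTree⊆ largest)
             (largest , centre∈shallowBall largest∈) (IsTree.connected (shallowTree-isTree largest∈))
      with u , v , u∈ , v∈ , eq ← diameter-attained {shallowTree largest} (shallowTree⊆ largest) isDiameter
      = δ , subst (_≤ suc ℓ) eq (shallowBall-bounded largest∈ u∈ v∈) , isDiameter

  leaving-edge : ∀ {X u v} → Walk T u v → u ∈ X → v ∉ X → ∃[ x ] ∃[ y ] x ~ y × x ∈ X × y ∉ X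
  leaving-edge (stop _) u∈ v∉ = contradiction u∈ v∉
  leaving-edge {X} (step {u} {w} u~w p) u∈ v∉ with w ∈? X
  ... | yes w∈ = leaving-edge p w∈ v∉
  ... | no w∉  = u , w , u~w , u∈ , w∉

  -- If y ∉ X, then adding y and the edge xy gives a larger bounded subgraph.
  maximum-closed : ∀ {X} → X ⊆ vertices T → (∀ {u v} → u ∈ X → v ∈ X → dist u v ≤ ℓ) →
                   size (induced T X) ≡ maxSize → ∀ {x y} → x ~ y → x ∈ X → y ∈ X
  maximum-closed {X} X⊆ X-bounded X-max {x} {y} x~y x∈ = decidable-stable (y ∈? X) λ y∉ →
    ℕ.n≮n maxSize (subst (_< maxSize) X-max (ℕ.≤-trans
      (Unique-⊆⇒length≤ (∉⇒Unique-∷ (xy∉ y∉) (edges-unique (induced T X))) edges⊆)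
      (bounded⇒size≤ {induced T Y} (induced-⊆ T Y⊆) Y-bounded)))
    where
    Y = X ∪ ⁅ y ⁆
    y∈T = ~⇒∈ʳ x~y

    Y⊆ : Y ⊆ vertices T
    Y⊆ z∈ with x∈p∪q⁻ X ⁅ y ⁆ z∈
    ... | inj₁ z∈X = X⊆ z∈X
    ... | inj₂ z∈y with refl ← x∈⁅y⁆⇒x≡y y z∈y = y∈T

    -- The slack between `ℓ` and `suc ℓ` pays for the new edge.
    to-y : ∀ {u} → u ∈ X → dist u y ≤ suc ℓ
    to-y u∈ = ℕ.≤-trans (dist-stepʳ x~y (X⊆ u∈)) (s≤s (X-bounded u∈ x∈))

    Y-bounded : Bounded Y
    Y-bounded u∈ v∈ with x∈p∪q⁻ X ⁅ y ⁆ u∈ | x∈p∪q⁻ X ⁅ y ⁆ v∈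
    ... | inj₁ u∈X | inj₁ v∈X = ℕ.m≤n⇒m≤1+n (X-bounded u∈X v∈X)
    ... | inj₁ u∈X | inj₂ v∈y with refl ← x∈⁅y⁆⇒x≡y y v∈y = to-y u∈X
    ... | inj₂ u∈y | inj₁ v∈X with refl ← x∈⁅y⁆⇒x≡y y u∈y = subst (_≤ suc ℓ) (dist-sym (X⊆ v∈X) y∈T) (to-y v∈X)
    ... | inj₂ u∈y | inj₂ v∈y with refl ← x∈⁅y⁆⇒x≡y y u∈y with refl ← x∈⁅y⁆⇒x≡y y v∈y =
      subst (_≤ suc ℓ) (sym (dist-refl y∈T)) z≤n

    xy∉ : y ∉ X → orient x y ∉ₗ edges (induced T X)
    xy∉ y∉ xy∈ with orient x y | orient-cases x y
    ... | _ | inj₁ refl = y∉ (proj₂ (proj₂ (induced-~⁻ T {X = X} (proj₂ (∈-edges⁻ (induced T X) xy∈)))))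
    ... | _ | inj₂ refl = y∉ (proj₁ (proj₂ (induced-~⁻ T {X = X} (proj₂ (∈-edges⁻ (induced T X) xy∈)))))

    edges⊆ : orient x y ∷ edges (induced T X) ⊆ₗ edges (induced T Y)
    edges⊆ (here refl) = orient-∈-edges (induced T Y)
      (induced-~⁺ T {X = Y} x~y (p⊆p∪q ⁅ y ⁆ x∈) (q⊆p∪q X ⁅ y ⁆ (x∈⁅x⁆ y)))
    edges⊆ {u , v} (there uv∈) =
      let u<v , uv         = ∈-edges⁻ (induced T X) uv∈
          u~v , u∈X , v∈X = induced-~⁻ T {X = X} uv
      in ∈-edges⁺ (induced T Y) u<v (induced-~⁺ T {X = Y} u~v (p⊆p∪q ⁅ y ⁆ u∈X) (p⊆p∪q ⁅ y ⁆ v∈X))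

  -- If the diameter were at most `ℓ`, no edge of `T` could leave the tree by `maximum-closed`, so
  -- it would span `T`. Then no two vertices of `T` would be at distance `suc ℓ`, against the given
  -- subtree.
  largestTree-diameter-exact : (∃[ m ] SubtreeOfDiameter T (suc ℓ) m) → IsDiameter (shallowTree largest) (suc ℓ)
  largestTree-diameter-exact (_ , S , (S⊆T , isTreeS) , isDiameterS , _)
    with δ , δ≤ , isDiameter ← largestTree-diameter
    with ℕ.m≤n⇒m<n∨m≡n δ≤
  ... | inj₂ refl = isDiameter
  ... | inj₁ (s≤s δ≤ℓ)
    with a , b , a∈ , b∈ , eq ← diameter-attained S⊆T isDiameterS
    = contradiction (subst (_≤ ℓ) eq (small (spanning (vertices-⊆ S⊆T a∈)) (spanning (vertices-⊆ S⊆T b∈))))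
        (ℕ.n≮n ℓ)
    where
    X = shallowBall largest

    small : ∀ {u v} → u ∈ X → v ∈ X → dist u v ≤ ℓ
    small u∈ v∈ = ℕ.≤-trans (dist≤diameter {shallowTree largest} (shallowTree⊆ largest) isDiameter
      (IsTree.connected (shallowTree-isTree largest∈)) u∈ v∈) δ≤ℓ

    spanning : vertices T ⊆ X
    spanning {v} v∈ = decidable-stable (v ∈? X) λ v∉ →
      let p                    = Path.walk (connected largest∈ v∈)
          _ , _ , x~y , x∈ , y∉ = leaving-edge {X} p (centre∈shallowBall largest∈) v∉
      in y∉ (maximum-closed {X} shallowBall⊆ small size-largest x~y x∈)

  isMaxSubtreeSize : IsMaxSubtreeSize T (suc ℓ) maxSize
  isMaxSubtreeSize =
    (λ exists → (shallowTree largest , largestTree-isSubtree , largestTree-diameter-exact exists , size-largest) ,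
                 λ k S → below k (suc ℓ , ℕ.≤-refl , S)) ,
    (let δ , δ≤ , isDiameter = largestTree-diameter
     in δ , δ≤ , shallowTree largest , largestTree-isSubtree , isDiameter , size-largest) ,
    below
    where
    below : ∀ k → SubtreeOfDiameterAtMost T (suc ℓ) k → k ≤ maxSize
    below _ (_ , δ≤ , S , subtree , isDiameter , refl) =
      bounded⇒size≤ (proj₁ subtree) (diameter⇒bounded subtree isDiameter δ≤)

corollary2p5 : ∀ {n : ℕ} (T : Graph n) → IsTree T → Nontrivial T →
    ∀ (ℓ : ℕ) → 1 ≤ ℓ →
    ∃[ k ] (IsPC₁ T ℓ k × IsMaxSubtreeSize T (ℓ + 1) k)
corollary2p5 T isTree _ ℓ _ =
  maxSize , isPC₁ , subst (λ D → IsMaxSubtreeSize T D maxSize) (ℕ.+-comm 1 ℓ) isMaxSubtreeSize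
  where open Extremal T isTree ℓ
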